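{- Let $k\ge1$, let $x\in\tilde S_{k+1}$ be an affine permutation with maximal decomposition $x=d_{A_n}\cdots d_{A_1}$ into cyclically decreasing elements, and let $T=\sigma(x)$ be its $k$-code filling. Then $r\in D_R(x)$ if and only if $r$ appears in the first row of $T$ and the column of $T$ containing this box contains a right descent of one of the $d_{A_i}$ (i.e. for some row $i$, the residue $m$ of the box of $T$ in that column and row $i$ is in $D_R(d_{A_i})$).
   Context: Fix $k\ge1$, $I=\mathbb Z/(k+1)\mathbb Z$. $\tilde S_{k+1}$ is the affine symmetric group with simple generators $s_i$, $i\in I$. The affine nil-Coxeter monoid is generated by $a_i$ ($i\in I$) and an absorbing zero, with relations $a_i^2=0$, $a_ia_j=a_ja_i$ for $j\notin\{i-1,i,i+1\}$, and (for $k\ge2$) $a_ia_{i+1}a_i=a_{i+1}a_ia_{i+1}$; its nonzero elements are identified with affine permutations via reduced words. For $A\subsetneq I$, $d_A$ is the product of the $a_i$, $i\in A$, each once, with $a_j$ left of $a_{j-1}$ whenever $j,j-1\in A$. The right descent set is $D_R(w)=\{p\in I: wa_p=0\}$, equivalently the set of $p$ such that $w$ has a reduced word ending in $p$. Every affine permutation $x$ has a unique maximal decomposition $x=d_{A_n}\cdots d_{A_1}$ ($A_i\subsetneq I$ nonempty), i.e. with $(|A_1|,\dots,|A_n|)$ lexicographically maximal; it satisfies $A_{j+1}\subset A_j-1:=\{s-1:s\in A_j\}$. The filling $\sigma(x)$ is a diagram with rows $1,2,\dots,n$ (row 1 at the bottom) and columns indexed cyclically by $I$: for each $j$ and each $r\in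 A_j$ there is a box with residue $r$ in row $j$ and column $r+(j-1)$. (So the box in column $i$ and row $j$ has residue $i-(j-1)$, and each column consists of boxes in consecutive rows starting from row 1.) -}

module Defs where

open import Algebra.Bundles using (Monoid)
open import Data.Fin.Base using (Fin; toℕ)
open import Data.Fin.Subset as Subset using (Subset; Nonempty; _⊂_; ⊤)
open import Data.List.Base using (List; []; _∷_; [_]; _++_; length; lookup; map)
open import Data.List.Membership.Propositional using () renaming (_∈_ to _∈ˡ_)
open import Data.List.Properties using (++-assoc; ++-identityʳ)
open import Data.List.Relation.Binary.Lex.Strict using (Lex-≤)
open import Data.List.Relation.Unary.AllPairs using (AllPairs)
open import Data.List.Relation.Unary.Unique.Propositional using (Unique)
open import Data.Maybe.Base using (Maybe; just; nothing; zipWith)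
open import Data.Nat.Base using (ℕ; suc; _+_; _≤_; _<_)
open import Data.Nat.DivMod using (_mod_)
open import Data.Product.Base using (_,_)
open import Function.Bundles using (_⇔_)
open import Level using (0ℓ)
open import Relation.Binary.Core using (Rel)
open import Relation.Binary.PropositionalEquality.Core using (_≡_; _≢_; refl; cong)
open import Relation.Nullary.Negation.Core using (¬_)
open import Relation.Unary using (Pred)

module NilCoxeter (k : ℕ) where

  -- ℤ/(k+1)ℤ, represented by 0, …, k.
  I : Set
  I = Fin (suc k)

  infixl 6 _⊕_

  _⊕_ : I → ℕ → I
  i ⊕ m = (toℕ i + m) mod suc k

  ----------------------------------------------------------------------
  -- The affine nil-Coxeter monoid, as a setoid on words with a zero.
  -- Words are read from left to right.

  Word : Set
  Word = List I

  Element : Set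
  Element = Maybe Word

  0# : Element
  0# = nothing

  ε : Element
  ε = just []

  a : I → Element
  a i = just [ i ]

  infixl 7 _∙_

  _∙_ : Element → Element → Element
  _∙_ = zipWith _++_

  infix 4 _≈_

  -- The least congruence containing the defining relations.
  data _≈_ : Rel Element 0ℓ where
    ≈-refl   : ∀ {x} → x ≈ x
    ≈-sym    : ∀ {x y} → x ≈ y → y ≈ x
    ≈-trans  : ∀ {x y z} → x ≈ y → y ≈ z → x ≈ z
    ∙-cong   : ∀ {x x′ y y′} → x ≈ x′ → y ≈ y′ → x ∙ y ≈ x′ ∙ y′
    a²≈0     : ∀ i → a i ∙ a i ≈ 0#
    -- The side conditions say j ≠ i, j ≠ i + 1 and j ≠ i − 1.
    commute  : ∀ i j → j ≢ i → j ≢ i ⊕ 1 → i ≢ j ⊕ 1 →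
               a i ∙ a j ≈ a j ∙ a i
    braid    : 2 ≤ k → ∀ i →
               a i ∙ a (i ⊕ 1) ∙ a i ≈ a (i ⊕ 1) ∙ a i ∙ a (i ⊕ 1)

  ≡⇒≈ : ∀ {x y} → x ≡ y → x ≈ y
  ≡⇒≈ refl = ≈-refl

  ∙-assoc : ∀ x y z → (x ∙ y) ∙ z ≡ x ∙ (y ∙ z)
  ∙-assoc (just u) (just v) (just w) = cong just (++-assoc u v w)
  ∙-assoc (just u) (just v) nothing  = refl
  ∙-assoc (just u) nothing  z        = refl
  ∙-assoc nothing  y        z        = refl

  ∙-identityˡ : ∀ x → ε ∙ x ≡ x
  ∙-identityˡ (just u) = refl
  ∙-identityˡ nothing  = refl

  ∙-identityʳ : ∀ x → x ∙ ε ≡ x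
  ∙-identityʳ (just u) = cong just (++-identityʳ u)
  ∙-identityʳ nothing  = refl

  monoid : Monoid 0ℓ 0ℓ
  monoid = record
    { Carrier  = Element
    ; _≈_      = _≈_
    ; _∙_      = _∙_
    ; ε        = ε
    ; isMonoid = record
      { isSemigroup = record
        { isMagma = record
          { isEquivalence = record
            { refl = ≈-refl ; sym = ≈-sym ; trans = ≈-trans }
          ; ∙-cong = ∙-cong
          }
        ; assoc = λ x y z → ≡⇒≈ (∙-assoc x y z)
        }
      ; identity = (λ x → ≡⇒≈ (∙-identityˡ x)) , (λ x → ≡⇒≈ (∙-identityʳ x))
      }
    }

  -- Reduced words identify the affine symmetric group with the nonzero
  -- elements of the monoid.
  record AffinePermutation : Set where
    field
      element : Element
      nonzero : ¬ element ≈ 0#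

  open AffinePermutation public

  -- Right descents.
  D_R : Element → Pred I 0ℓ
  D_R w p = w ∙ a p ≈ 0#

  ----------------------------------------------------------------------
  -- Cyclically decreasing elements

  -- w spells d_A: every letter of A occurs exactly once, and j + 1 never
  -- occurs to the right of j.
  record Spells-d (A : Subset (suc k)) (w : Word) : Set where
    field
      letters    : ∀ i → i ∈ˡ w ⇔ i Subset.∈ A
      once       : Unique w
      decreasing : AllPairs (λ i j → j ≢ i ⊕ 1) w

  -- d_A for ∅ ≠ A ⊊ I. Different words spelling the same d_A differ only by
  -- commutations, so carrying one of them amounts to carrying A alone.
  record Factor : Set where
    field
      A        : Subset (suc k)
      nonempty : Nonempty A
      proper   : A ⊂ ⊤
      word     : Word
      spells   : Spells-d A word

    d : Element
    d = just word

    size : ℕ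
    size = Subset.∣ A ∣

  open Factor public using (A; d; size)

  -- The list A₁ , … , Aₙ stands for the product d_{Aₙ} ⋯ d_{A₁}: the head of
  -- the list is the rightmost factor.
  Factors : Set
  Factors = List Factor

  product : Factors → Element
  product []       = ε
  product (f ∷ fs) = product fs ∙ d f

  infix 4 _≤ₗₑₓ_

  _≤ₗₑₓ_ : Rel (List ℕ) 0ℓ
  _≤ₗₑₓ_ = Lex-≤ _≡_ _<_

  record IsMaximalDecomposition (x : AffinePermutation) (fs : Factors) : Set where
    field
      decomposes : element x ≈ product fs
      maximal    : ∀ gs → element x ≈ product gs → map size gs ≤ₗₑₓ map size fs

  ----------------------------------------------------------------------
  -- The filling σ(x), as the set of its boxes, computed from the maximal
  -- decomposition of x. Rows are indexed from 0, so that the row called j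
  -- here is row j + 1 of the diagram and contains the residues in A_{j+1}.

  record Box (fs : Factors) : Set where
    field
      row     : Fin (length fs)
      residue : I
      inside  : residue Subset.∈ A (lookup fs row)

    column : I
    column = residue ⊕ toℕ row

    InFirstRow : Set
    InFirstRow = toℕ row ≡ 0

    -- The residue is a right descent of the factor giving the box's row.
    IsDescent : Set
    IsDescent = D_R (d (lookup fs row)) residue

  open Box public using (row; residue; column; InFirstRow; IsDescent)

{-# OPTIONS --safe #-}
module Submission where

-- Two rewriting rules for r ∈ A drive everything: d_A a_r = 0 if r − 1 ∉ A, and
-- d_A a_r = a_{r−1} d_A if r − 1 ∈ A. Hence a_r climbs its column of the filling and
-- kills x as soon as it meets a descent.
-- If s ∈ A_{j+1} and s + 1 ∉ A_j, commutations and braid moves either show that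
-- d_{A_{j+1}} d_{A_j} = 0 or enlarge A_j at the expense of A_{j+1}; so maximality
-- forces A_{j+1} ⊆ A_j − 1.
-- For the converse, let the monoid act on affine permutations, with a_i swapping an
-- ascent at i and killing a descent. Reading a nested product from the left, every
-- position t + 1 with t ∉ A_j holds a left-to-right maximum after d_{A_j} is applied,
-- so the next factor acts without vanishing, and the descents of the result obey
-- the same column recursion as those of the filling.

open import Algebra.Bundles using (Monoid)
open import Data.Empty using (⊥)
open import Data.Fin.Base using (zero; suc; toℕ)
open import Data.Fin.Properties using (toℕ-injective; toℕ-fromℕ<; toℕ<n; any?; _≟_)
open import Data.Fin.Subset as Subset using (Subset)
open import Data.Fin.Subset.Properties
  using (_∈?_; ∈⊤; ∉⊥; x∈⁅x⁆; x∈⁅y⁆⇒x≡y; x∈p∪q⁺; x∈p∪q⁻; p⊂q⇒∣p∣<∣q∣)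
open import Data.List.Base using (List; []; _∷_; _++_; length; map; foldr)
open import Data.List.Membership.Propositional using () renaming (_∈_ to _∈ˡ_; _∉_ to _∉ˡ_)
open import Data.List.Membership.Propositional.Properties using (∈-∃++; ∈-++⁺ˡ; ∈-++⁺ʳ; ∈-++⁻)
open import Data.List.Properties using (length-++-≤ʳ)
open import Data.List.Relation.Binary.Lex.Strict using (this; next)
open import Data.List.Relation.Binary.Permutation.Propositional
  using (_↭_; prep; swap; ↭-refl; ↭-sym; ↭-trans)
open import Data.List.Relation.Binary.Permutation.Propositional.Properties using (shift; ∈-resp-↭)
open import Data.List.Relation.Binary.Sublist.Propositional as Sublist
  using (_⊆_; _∷ʳ_; ⊆-refl)
open import Data.List.Relation.Binary.Sublist.Propositional.Properties
  using (All-resp-⊆; ++⁺)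
open import Data.List.Relation.Unary.All as All using (All; []; _∷_)
import Data.List.Relation.Unary.All.Properties as All
open import Data.List.Relation.Unary.AllPairs as AllPairs using (AllPairs; []; _∷_)
open import Data.List.Relation.Unary.Any using (here; there)
open import Data.List.Relation.Unary.Linked as Linked using (Linked; []; [-]; _∷_)
open import Data.Maybe.Base using (just; nothing)
open import Data.Nat.Base using (ℕ; zero; suc; _+_; _∸_; _≤_; _<_; z≤n; s≤s)
open import Data.Nat.DivMod
  using (_%_; m%n<n; m%n%n≡m%n; %-distribˡ-+; [m+n]%n≡m%n; m<n⇒m%n≡m; m≤n⇒[n∸m]%m≡n%m)
import Data.Nat.Properties as ℕ
open import Data.Integer.Base as ℤ using (ℤ; 0ℤ; +_)
import Data.Integer.Properties as ℤ
open import Data.Product.Base using (Σ-syntax; ∃; _×_; _,_; proj₁; proj₂)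
open import Data.Sum.Base using (_⊎_; inj₁; inj₂; [_,_]′)
open import Data.Unit.Base using (⊤)
open import Function.Base using (_∘_; _$_)
open import Function.Bundles using (_⇔_; mk⇔; Equivalence)
open import Relation.Binary.PropositionalEquality.Core
  using (_≡_; _≢_; refl; sym; trans; cong; subst; subst₂; _≗_)
open import Relation.Binary.PropositionalEquality.Properties using (module ≡-Reasoning)
open import Relation.Nullary.Decidable.Core using (Dec; yes; no; _×-dec_; _⊎-dec_; ¬?; decidable-stable)
open import Relation.Nullary.Negation.Core using (¬_; contradiction)
open import Relation.Unary using (_∈_)
open import Tactic.MonoidSolver using (solve)
open import Defs

-- Pairwise relations on lists

AllPairs-++⁻ : ∀ {A : Set} {R : A → A → Set} xs {ys} → AllPairs R (xs ++ ys) →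
               AllPairs R xs × AllPairs R ys × (∀ {x y} → x ∈ˡ xs → y ∈ˡ ys → R x y)
AllPairs-++⁻ []       ps       = [] , ps , λ ()
AllPairs-++⁻ (x ∷ xs) (p ∷ ps) with AllPairs-++⁻ xs ps
... | pxs , pys , R-xs-ys = All.++⁻ˡ xs p ∷ pxs , pys , λ where
  (here refl) y∈ys → All.lookup (All.++⁻ʳ xs p) y∈ys
  (there x∈xs) y∈ys → R-xs-ys x∈xs y∈ys

AllPairs-resp-⊆ : ∀ {A : Set} {R : A → A → Set} {xs ys} → xs ⊆ ys → AllPairs R ys → AllPairs R xs
AllPairs-resp-⊆ Sublist.[]         []       = []
AllPairs-resp-⊆ (y ∷ʳ τ)           (p ∷ ps) = AllPairs-resp-⊆ τ ps
AllPairs-resp-⊆ (refl Sublist.∷ τ) (p ∷ ps) = All-resp-⊆ τ p ∷ AllPairs-resp-⊆ τ ps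

module Descents (k : ℕ) (1≤k : 1 ≤ k) where
  open NilCoxeter k

  -- The cyclic group of residues

  ⊕-⊕ : ∀ i l m → i ⊕ l ⊕ m ≡ i ⊕ (l + m)
  ⊕-⊕ i l m = toℕ-injective $ begin
    toℕ (i ⊕ l ⊕ m)                             ≡⟨ toℕ-fromℕ< _ ⟩
    (toℕ (i ⊕ l) + m) % suc k
      ≡⟨ cong (λ z → (z + m) % suc k) (toℕ-fromℕ< (m%n<n (toℕ i + l) (suc k))) ⟩
    ((toℕ i + l) % suc k + m) % suc k           ≡⟨ %-distribˡ-+ ((toℕ i + l) % suc k) m (suc k) ⟩
    ((toℕ i + l) % suc k % suc k + m % suc k) % suc k
      ≡⟨ cong (λ z → (z + m % suc k) % suc k) (m%n%n≡m%n (toℕ i + l) (suc k)) ⟩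
    ((toℕ i + l) % suc k + m % suc k) % suc k   ≡⟨ %-distribˡ-+ (toℕ i + l) m (suc k) ⟨
    (toℕ i + l + m) % suc k                     ≡⟨ cong (_% suc k) (ℕ.+-assoc (toℕ i) l m) ⟩
    (toℕ i + (l + m)) % suc k                   ≡⟨ toℕ-fromℕ< _ ⟨
    toℕ (i ⊕ (l + m))                           ∎
    where open ≡-Reasoning

  ⊕-identityʳ : ∀ i → i ⊕ 0 ≡ i
  ⊕-identityʳ i = toℕ-injective $ begin
    toℕ (i ⊕ 0)           ≡⟨ toℕ-fromℕ< _ ⟩
    (toℕ i + 0) % suc k   ≡⟨ cong (_% suc k) (ℕ.+-identityʳ (toℕ i)) ⟩
    toℕ i % suc k         ≡⟨ m<n⇒m%n≡m (toℕ<n i) ⟩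
    toℕ i                 ∎
    where open ≡-Reasoning

  ⊕-period : ∀ i → i ⊕ suc k ≡ i
  ⊕-period i = toℕ-injective $ begin
    toℕ (i ⊕ suc k)           ≡⟨ toℕ-fromℕ< _ ⟩
    (toℕ i + suc k) % suc k   ≡⟨ [m+n]%n≡m%n (toℕ i) (suc k) ⟩
    toℕ i % suc k             ≡⟨ m<n⇒m%n≡m (toℕ<n i) ⟩
    toℕ i                     ∎
    where open ≡-Reasoning

  pred : I → I
  pred i = i ⊕ k

  pred-⊕1 : ∀ i → pred i ⊕ 1 ≡ i
  pred-⊕1 i = trans (⊕-⊕ i k 1) (trans (cong (i ⊕_) (ℕ.+-comm k 1)) (⊕-period i))

  ⊕1-pred : ∀ i → pred (i ⊕ 1) ≡ i
  ⊕1-pred i = trans (⊕-⊕ i 1 k) (⊕-period i)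

  ⊕1-injective : ∀ {i j} → i ⊕ 1 ≡ j ⊕ 1 → i ≡ j
  ⊕1-injective {i} {j} eq = trans (sym (⊕1-pred i)) (trans (cong pred eq) (⊕1-pred j))

  -- Adding m either stays within 0, ..., k or wraps around once; each case cancels to an excluded
  -- value of m.
  ⊕≢ : ∀ i {m} → 0 < m → m < suc k → i ⊕ m ≢ i
  ⊕≢ i {m} 0<m m<n eq with toℕ i + m ℕ.<? suc k
  ... | yes i+m<n = ℕ.<⇒≢ 0<m $ ℕ.+-cancelˡ-≡ (toℕ i) 0 m $ begin
    toℕ i + 0             ≡⟨ ℕ.+-identityʳ (toℕ i) ⟩
    toℕ i                 ≡⟨ cong toℕ eq ⟨
    toℕ (i ⊕ m)           ≡⟨ toℕ-fromℕ< _ ⟩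
    (toℕ i + m) % suc k   ≡⟨ m<n⇒m%n≡m i+m<n ⟩
    toℕ i + m             ∎
    where open ≡-Reasoning
  ... | no i+m≮n = ℕ.<⇒≢ m<n $ ℕ.+-cancelˡ-≡ (toℕ i) m (suc k) $ begin
    toℕ i + m                             ≡⟨ ℕ.m∸n+n≡m n≤i+m ⟨
    toℕ i + m ∸ suc k + suc k             ≡⟨ cong (_+ suc k) (m<n⇒m%n≡m i+m∸n<n) ⟨
    (toℕ i + m ∸ suc k) % suc k + suc k   ≡⟨ cong (_+ suc k) (m≤n⇒[n∸m]%m≡n%m n≤i+m) ⟩
    (toℕ i + m) % suc k + suc k           ≡⟨ cong (_+ suc k) (toℕ-fromℕ< _) ⟨
    toℕ (i ⊕ m) + suc k                   ≡⟨ cong (λ j → toℕ j + suc k) eq ⟩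
    toℕ i + suc k                         ∎
    where
    open ≡-Reasoning
    n≤i+m : suc k ≤ toℕ i + m
    n≤i+m = ℕ.≮⇒≥ i+m≮n
    i+m∸n<n : toℕ i + m ∸ suc k < suc k
    i+m∸n<n = ℕ.m<n+o⇒m∸n<o (toℕ i + m) (suc k) (ℕ.+-mono-< (toℕ<n i) m<n)

  ⊕1≢ : ∀ i → i ⊕ 1 ≢ i
  ⊕1≢ i = ⊕≢ i ℕ.≤-refl (s≤s 1≤k)

  ⊕1⊕1≢ : 2 ≤ k → ∀ i → i ⊕ 1 ⊕ 1 ≢ i
  ⊕1⊕1≢ 2≤k i eq = ⊕≢ i (s≤s z≤n) (s≤s 2≤k) (trans (sym (⊕-⊕ i 1 1)) eq)

  pred≢ : ∀ i → pred i ≢ i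
  pred≢ i eq = ⊕1≢ i (trans (cong (_⊕ 1) (sym eq)) (pred-⊕1 i))

  -- For k = 1 the residues i - 1 and i + 1 coincide, so their distinctness supplies the side
  -- condition of the braid relation.
  pred≢⊕1⇒2≤k : ∀ i → pred i ≢ i ⊕ 1 → 2 ≤ k
  pred≢⊕1⇒2≤k i neq = ℕ.≤∧≢⇒< 1≤k λ 1≡k → neq (cong (i ⊕_) (sym 1≡k))

  open import Data.List.Membership.DecPropositional (_≟_ {suc k}) using () renaming (_∈?_ to _∈ˡ?_)

  -- Calculus in the nil-Coxeter monoid

  open import Relation.Binary.Reasoning.Setoid (Monoid.setoid monoid)

  ∙-congˡ : ∀ {x y z} → y ≈ z → x ∙ y ≈ x ∙ z
  ∙-congˡ = ∙-cong ≈-refl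

  ∙-congʳ : ∀ {x y z} → x ≈ y → x ∙ z ≈ y ∙ z
  ∙-congʳ eq = ∙-cong eq ≈-refl

  zeroʳ : ∀ x → x ∙ 0# ≈ 0#
  zeroʳ (just _) = ≈-refl
  zeroʳ nothing  = ≈-refl

  ∙-assoc₄ : ∀ x y z w → x ∙ (y ∙ z) ∙ w ≈ x ∙ y ∙ (z ∙ w)
  ∙-assoc₄ x y z w = solve monoid

  Commute : Element → Element → Set
  Commute x y = x ∙ y ≈ y ∙ x

  commute-∙ : ∀ {x y z} → Commute x y → Commute x z → Commute x (y ∙ z)
  commute-∙ {x} {y} {z} xy xz = begin
    x ∙ (y ∙ z)   ≈⟨ solve monoid ⟩
    (x ∙ y) ∙ z   ≈⟨ ∙-congʳ xy ⟩
    (y ∙ x) ∙ z   ≈⟨ solve monoid ⟩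
    y ∙ (x ∙ z)   ≈⟨ ∙-congˡ xz ⟩
    y ∙ (z ∙ x)   ≈⟨ solve monoid ⟩
    (y ∙ z) ∙ x   ∎

  Far : I → I → Set
  Far i j = j ≢ i × j ≢ i ⊕ 1 × i ≢ j ⊕ 1

  commute-word : ∀ {s} v → (∀ {j} → j ∈ˡ v → Far s j) → Commute (a s) (just v)
  commute-word         []      far = ≈-refl
  commute-word {s = s} (j ∷ v) far with far (here refl)
  ... | j≢s , j≢s+1 , s≢j+1 =
    commute-∙ {a s} {a j} {just v} (commute s j j≢s j≢s+1 s≢j+1) (commute-word v (far ∘ there))

  braid-pred : ∀ {s} → pred s ≢ s ⊕ 1 →
               a s ∙ (a (pred s) ∙ a s) ≈ a (pred s) ∙ (a s ∙ a (pred s))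
  braid-pred {s} neq = ≈-sym (subst (λ r → a (pred s) ∙ a r ∙ a (pred s) ≈ a r ∙ a (pred s) ∙ a r)
    (pred-⊕1 s) (braid (pred≢⊕1⇒2≤k s neq) (pred s)))

  -- Cyclically decreasing words

  infix 4 _▷_

  -- The condition for i to stand anywhere to the left of j in a word for some d_A; it merges `once`
  -- with `decreasing`.
  _▷_ : I → I → Set
  i ▷ j = i ≢ j × j ≢ i ⊕ 1

  CycDec : Word → Set
  CycDec = AllPairs _▷_

  spells⇒cycDec : ∀ {A w} → Spells-d A w → CycDec w
  spells⇒cycDec sp = AllPairs.zip (Spells-d.once sp , Spells-d.decreasing sp)

  -- The order of the word rules out one neighbour: to the left of s only s + 1 can fail to commute
  -- with s, to the right only s - 1.
  far-left : ∀ {j s} → j ▷ s → j ≢ s ⊕ 1 → Far s j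
  far-left (j≢s , s≢j+1) j≢s+1 = j≢s , j≢s+1 , s≢j+1

  far-right : ∀ {s j} → s ▷ j → j ≢ pred s → Far s j
  far-right {s} {j} (s≢j , j≢s+1) j≢s-1 =
    s≢j ∘ sym , j≢s+1 , λ s≡j+1 → j≢s-1 (trans (sym (⊕1-pred j)) (cong pred (sym s≡j+1)))

  record Split (w : Word) (s : I) : Set where
    field
      u v    : Word
      eq     : w ≡ u ++ s ∷ v
      before : ∀ {i j} → i ∈ˡ u → j ∈ˡ s ∷ v → i ▷ j
      cyc-u  : CycDec u
      cyc-sv : CycDec (s ∷ v)

  split : ∀ {w s} → CycDec w → s ∈ˡ w → Split w s
  split cw s∈w with ∈-∃++ s∈w
  ... | u , v , refl with AllPairs-++⁻ u cw
  ... | cyc-u , cyc-sv , before = record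
    { u = u ; v = v ; eq = refl ; before = before ; cyc-u = cyc-u ; cyc-sv = cyc-sv }

  cycDec-⊕1∉ : ∀ {s v} → CycDec (s ∷ v) → s ⊕ 1 ∉ˡ s ∷ v
  cycDec-⊕1∉ {s} _  (here eq)  = ⊕1≢ s eq
  cycDec-⊕1∉ (p ∷ _) (there i) = proj₂ (All.lookup p i) refl

  pull-left : ∀ {w s} (sp : Split w s) (let open Split sp) → s ⊕ 1 ∉ˡ w →
              just w ≈ a s ∙ just (u ++ v)
  pull-left {s = s} record { u = u ; v = v ; eq = refl ; before = before } s+1∉w = begin
    just u ∙ (a s ∙ just v)   ≈⟨ ≡⇒≈ (∙-assoc (just u) (a s) (just v)) ⟨
    just u ∙ a s ∙ just v     ≈⟨ ∙-congʳ {z = just v} (commute-word u far) ⟨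
    a s ∙ just u ∙ just v     ≈⟨ ≡⇒≈ (∙-assoc (a s) (just u) (just v)) ⟩
    a s ∙ (just u ∙ just v)   ∎
    where
    far : ∀ {j} → j ∈ˡ u → Far s j
    far j∈u = far-left (before j∈u (here refl)) λ { refl → s+1∉w (∈-++⁺ˡ j∈u) }

  left-zero : ∀ {w s} → CycDec w → s ∈ˡ w → s ⊕ 1 ∉ˡ w → a s ∙ just w ≈ 0#
  left-zero {w} {s} cw s∈w s+1∉w = begin
    a s ∙ just w                ≈⟨ ∙-congˡ {a s} (pull-left sp s+1∉w) ⟩
    a s ∙ (a s ∙ just (u ++ v)) ≈⟨ ∙-congʳ {z = just (u ++ v)} (a²≈0 s) ⟩
    0#                          ∎
    where
    sp = split cw s∈w
    open Split sp

  -- With r - 1 absent, the appended r commutes leftwards until it meets the r of the word, and a_r²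
  -- = 0.
  right-zero : ∀ {w r} → CycDec w → r ∈ˡ w → pred r ∉ˡ w → just w ∙ a r ≈ 0#
  right-zero {r = r} cw r∈w r-1∉w with split cw r∈w
  ... | record { u = u ; v = v ; eq = refl ; cyc-sv = p ∷ _ } = begin
    just u ∙ (a r ∙ just v) ∙ a r   ≈⟨ ≡⇒≈ (∙-assoc (just u) (just (r ∷ v)) (a r)) ⟩
    just u ∙ (a r ∙ (just v ∙ a r)) ≈⟨ ∙-congˡ {just u} (∙-congˡ {a r} (commute-word v far)) ⟨
    just u ∙ (a r ∙ (a r ∙ just v)) ≈⟨ ∙-congˡ {just u} (∙-congʳ {z = just v} (a²≈0 r)) ⟩
    0#                              ∎
    where
    far : ∀ {j} → j ∈ˡ v → Far r j
    far j∈v = far-right (All.lookup p j∈v) λ { refl → r-1∉w (∈-++⁺ʳ u (there j∈v)) }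

  -- Write the word as u r v t z with t = r - 1. The appended r passes z and the first r passes v,
  -- so that r t r = t r t applies; then the left t passes v and u, and r returns across v.
  slide : ∀ {w r} → CycDec w → r ∈ˡ w → pred r ∈ˡ w → just w ∙ a r ≈ a (pred r) ∙ just w
  slide {r = r} cw r∈w t∈w with split cw r∈w
  ... | record { u = u ; v = y ; eq = refl ; before = before ; cyc-sv = cy@(p ∷ cyc-y) }
    with ∈-++⁻ u t∈w
  -- A letter t to the left of r = t + 1 would violate cyclic decrease.
  ... | inj₁ t∈u = contradiction (sym (pred-⊕1 r)) (proj₂ (before t∈u (here refl)))
  ... | inj₂ (here t≡r) = contradiction t≡r (pred≢ r)
  ... | inj₂ (there t∈y) with split cyc-y t∈y
  ... | record { u = v ; v = z ; eq = refl ; before = before′ ; cyc-sv = q ∷ _ } =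
    conjugate (just u) (just v) (just z)
      (commute-word u far-u) (commute-word v far-v) (commute-word v far-v′) (commute-word z far-z)
    where
    t = pred r

    conjugate : ∀ U V Z → Commute (a t) U → Commute (a r) V → Commute (a t) V → Commute (a r) Z →
                U ∙ (a r ∙ (V ∙ (a t ∙ Z))) ∙ a r ≈ a t ∙ (U ∙ (a r ∙ (V ∙ (a t ∙ Z))))
    conjugate U V Z tU rV tV rZ = go (a t) (a r) tU rV tV rZ
                                     -- Since r precedes t, the relation r ▷ t excludes t = r + 1,
                                     -- hence also k = 1.
                                     (braid-pred (proj₂ (All.lookup p t∈y)))
      where
      go : ∀ T R → Commute T U → Commute R V → Commute T V → Commute R Z →
           R ∙ (T ∙ R) ≈ T ∙ (R ∙ T) →
           U ∙ (R ∙ (V ∙ (T ∙ Z))) ∙ R ≈ T ∙ (U ∙ (R ∙ (V ∙ (T ∙ Z))))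
      go T R TU RV TV RZ br = begin
        U ∙ (R ∙ (V ∙ (T ∙ Z))) ∙ R     ≈⟨ solve monoid ⟩
        U ∙ (R ∙ V) ∙ (T ∙ (Z ∙ R))     ≈⟨ ∙-cong (∙-congˡ RV) (∙-congˡ (≈-sym RZ)) ⟩
        U ∙ (V ∙ R) ∙ (T ∙ (R ∙ Z))     ≈⟨ solve monoid ⟩
        U ∙ V ∙ (R ∙ (T ∙ R)) ∙ Z       ≈⟨ ∙-congʳ (∙-congˡ br) ⟩
        U ∙ V ∙ (T ∙ (R ∙ T)) ∙ Z       ≈⟨ solve monoid ⟩
        U ∙ (V ∙ T) ∙ R ∙ T ∙ Z         ≈⟨ ∙-congʳ (∙-congʳ (∙-congʳ (∙-congˡ (≈-sym TV)))) ⟩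
        U ∙ (T ∙ V) ∙ R ∙ T ∙ Z         ≈⟨ solve monoid ⟩
        (U ∙ T) ∙ (V ∙ R) ∙ T ∙ Z       ≈⟨ ∙-congʳ (∙-congʳ (∙-cong (≈-sym TU) (≈-sym RV))) ⟩
        (T ∙ U) ∙ (R ∙ V) ∙ T ∙ Z       ≈⟨ solve monoid ⟩
        T ∙ (U ∙ (R ∙ (V ∙ (T ∙ Z))))   ∎

    far-u : ∀ {j} → j ∈ˡ u → Far t j
    far-u j∈u = far-left (before j∈u (there (∈-++⁺ʳ v (here refl))))
      λ { refl → proj₁ (before j∈u (here refl)) (pred-⊕1 r) }

    far-v : ∀ {j} → j ∈ˡ v → Far r j
    far-v j∈v = far-right (All.lookup p (∈-++⁺ˡ j∈v)) (proj₁ (before′ j∈v (here refl)))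

    far-v′ : ∀ {j} → j ∈ˡ v → Far t j
    far-v′ j∈v = far-left (before′ j∈v (here refl))
      λ { refl → proj₁ (All.lookup p (∈-++⁺ˡ j∈v)) (sym (pred-⊕1 r)) }

    far-z : ∀ {j} → j ∈ˡ z → Far r j
    far-z j∈z = far-right (All.lookup p (∈-++⁺ʳ v (there j∈z))) (proj₁ (All.lookup q j∈z) ∘ sym)

  -- Pushing a letter into the neighbouring factor

  -- One letter of w moves into α, possibly renamed on its way.
  record Raise (w α : Word) : Set where
    field
      rest raised : Word
      -- The lexicographic comparison is decided by the raised factor, so a sublist is all that is
      -- asked of `rest`.
      rest⊆       : rest ⊆ w
      cyc-raised  : CycDec raised
      new         : I
      new∈        : new ∈ˡ w
      new∉        : new ∉ˡ α
      raised↭     : raised ↭ new ∷ α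
      factors     : just w ∙ just α ≈ just rest ∙ just raised

  -- If s + 1 ∉ α and s ∈ α, then α = s α₁, and a letter t = s − 1 on the left is
  -- absorbed by the braid relation in s t s = t s t; as s ∉ α₁, the rightmost t
  -- can be pushed into α₁ recursively.
  braid-through : ∀ S T V₁ V₂ A A₁ → Commute S V₁ → Commute S V₂ →
                  S ∙ (T ∙ S) ≈ T ∙ (S ∙ T) → A ≈ S ∙ A₁ →
                  (S ∙ (V₁ ∙ (T ∙ V₂))) ∙ A ≈ (V₁ ∙ (T ∙ S)) ∙ ((T ∙ V₂) ∙ A₁)
  braid-through S T V₁ V₂ A A₁ SV₁ SV₂ br A≈ = begin
    (S ∙ (V₁ ∙ (T ∙ V₂))) ∙ A           ≈⟨ ∙-congˡ A≈ ⟩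
    (S ∙ (V₁ ∙ (T ∙ V₂))) ∙ (S ∙ A₁)    ≈⟨ solve monoid ⟩
    (S ∙ V₁) ∙ T ∙ (V₂ ∙ S) ∙ A₁        ≈⟨ ∙-congʳ (∙-cong (∙-congʳ SV₁) (≈-sym SV₂)) ⟩
    (V₁ ∙ S) ∙ T ∙ (S ∙ V₂) ∙ A₁        ≈⟨ solve monoid ⟩
    V₁ ∙ (S ∙ (T ∙ S)) ∙ V₂ ∙ A₁        ≈⟨ ∙-congʳ (∙-congʳ (∙-congˡ br)) ⟩
    V₁ ∙ (T ∙ (S ∙ T)) ∙ V₂ ∙ A₁        ≈⟨ solve monoid ⟩
    (V₁ ∙ (T ∙ S)) ∙ ((T ∙ V₂) ∙ A₁)    ∎

  -- Induction on the bound `n` for the length of v. If s - 1 is absent from v, then s commutes to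
  -- the right end and either joins α or meets the s of α and gives zero. Otherwise the recursion
  -- continues with t = s - 1 and the letters after it.
  push : ∀ n s v α → length v < n → CycDec (s ∷ v) → CycDec α → s ⊕ 1 ∉ˡ α →
         just (s ∷ v) ∙ just α ≈ 0# ⊎ Raise (s ∷ v) α
  push (suc n) s v α (s≤s len) cw@(p ∷ cv) cα s+1∉α with pred s ∈ˡ? v | s ∈ˡ? α
  ... | no s-1∉v | no s∉α = inj₂ record
    { rest = v
    ; raised = s ∷ α
    ; rest⊆ = s ∷ʳ ⊆-refl
    ; cyc-raised = All.tabulate (λ j∈α → (λ { refl → s∉α j∈α }) , λ { refl → s+1∉α j∈α }) ∷ cα
    ; new = s
    ; new∈ = here refl
    ; new∉ = s∉α
    ; raised↭ = ↭-refl
    ; factors = begin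
        a s ∙ just v ∙ just α          ≈⟨ ∙-congʳ {z = just α} (commute-word v far) ⟩
        just v ∙ a s ∙ just α          ≈⟨ ≡⇒≈ (∙-assoc (just v) (a s) (just α)) ⟩
        just v ∙ just (s ∷ α)          ∎
    }
    where
    far : ∀ {j} → j ∈ˡ v → Far s j
    far j∈v = far-right (All.lookup p j∈v) λ { refl → s-1∉v j∈v }
  ... | no s-1∉v | yes s∈α = inj₁ $ begin
    a s ∙ just v ∙ just α          ≈⟨ ∙-congʳ {z = just α} (commute-word v far) ⟩
    just v ∙ a s ∙ just α          ≈⟨ ≡⇒≈ (∙-assoc (just v) (a s) (just α)) ⟩
    just v ∙ (a s ∙ just α)        ≈⟨ ∙-congˡ {just v} (left-zero cα s∈α s+1∉α) ⟩
    0#                             ∎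
    where
    far : ∀ {j} → j ∈ˡ v → Far s j
    far j∈v = far-right (All.lookup p j∈v) λ { refl → s-1∉v j∈v }
  ... | yes t∈v | s∈?α with split cv t∈v
  ... | record { u = v₁ ; v = v₂ ; eq = refl ; before = before ; cyc-sv = ct@(q ∷ _) } = go s∈?α
    where
    t = pred s

    len₂ : length v₂ < n
    len₂ = ℕ.≤-trans (length-++-≤ʳ (t ∷ v₂) {v₁}) len

    far₁ : ∀ {j} → j ∈ˡ v₁ → Far s j
    far₁ j∈v₁ = far-right (All.lookup p (∈-++⁺ˡ j∈v₁)) (proj₁ (before j∈v₁ (here refl)))

    far₂ : ∀ {j} → j ∈ˡ v₂ → Far s j
    far₂ j∈v₂ = far-right (All.lookup p (∈-++⁺ʳ v₁ (there j∈v₂))) (proj₁ (All.lookup q j∈v₂) ∘ sym)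

    s▷ : ∀ {j} → j ∈ˡ t ∷ v₂ → s ▷ j
    s▷ j∈ = All.lookup p (∈-++⁺ʳ v₁ j∈)

    br : a s ∙ (a t ∙ a s) ≈ a t ∙ (a s ∙ a t)
    br = braid-pred (proj₂ (s▷ (here refl)))

    go : Dec (s ∈ˡ α) → just (s ∷ v₁ ++ t ∷ v₂) ∙ just α ≈ 0# ⊎ Raise (s ∷ v₁ ++ t ∷ v₂) α
    -- As t + 1 = s, the case assumption s ∉ α is exactly the hypothesis of the recursive call.
    go (no s∉α) with push n t v₂ α len₂ ct cα (s∉α ∘ subst (_∈ˡ α) (pred-⊕1 s))
    ... | inj₁ ≈0 = inj₁ $ begin
      (a s ∙ (just v₁ ∙ just (t ∷ v₂))) ∙ just α   ≈⟨ ∙-assoc₄ (a s) (just v₁) (just (t ∷ v₂)) (just α) ⟩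
      just (s ∷ v₁) ∙ (just (t ∷ v₂) ∙ just α)     ≈⟨ ∙-congˡ {just (s ∷ v₁)} ≈0 ⟩
      0#                                           ∎
    ... | inj₂ R = inj₂ record
      { rest = s ∷ v₁ ++ rest
      ; raised = raised
      ; rest⊆ = refl Sublist.∷ ++⁺ ⊆-refl rest⊆
      ; cyc-raised = cyc-raised
      ; new = new
      ; new∈ = there (∈-++⁺ʳ v₁ new∈)
      ; new∉ = new∉
      ; raised↭ = raised↭
      ; factors = begin
          (a s ∙ (just v₁ ∙ just (t ∷ v₂))) ∙ just α
            ≈⟨ ∙-assoc₄ (a s) (just v₁) (just (t ∷ v₂)) (just α) ⟩
          just (s ∷ v₁) ∙ (just (t ∷ v₂) ∙ just α)
            ≈⟨ ∙-congˡ {just (s ∷ v₁)} factors ⟩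
          just (s ∷ v₁) ∙ (just rest ∙ just raised)
            ≈⟨ ∙-assoc₄ (a s) (just v₁) (just rest) (just raised) ⟨
          (a s ∙ (just v₁ ∙ just rest)) ∙ just raised ∎
      }
      where open Raise R
    go (yes s∈α) with split cα s∈α
    ... | sp@record { u = β ; v = γ ; eq = refl ; before = before′ ; cyc-sv = q′ ∷ _ }
      with push n t v₂ (β ++ γ) len₂ ct
             (AllPairs-resp-⊆ (++⁺ (⊆-refl {x = β}) (s ∷ʳ ⊆-refl)) cα)
             (s∉α₁ ∘ subst (_∈ˡ β ++ γ) (pred-⊕1 s))
      where
      s∉α₁ : s ∉ˡ β ++ γ
      s∉α₁ s∈ with ∈-++⁻ β s∈
      ... | inj₁ s∈β = proj₁ (before′ s∈β (here refl)) refl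
      ... | inj₂ s∈γ = proj₁ (All.lookup q′ s∈γ) refl
    ... | inj₁ ≈0 = inj₁ $ begin
      just (s ∷ v₁ ++ t ∷ v₂) ∙ just α
        ≈⟨ braid-through (a s) (a t) (just v₁) (just v₂) (just α) (just (β ++ γ))
             (commute-word v₁ far₁) (commute-word v₂ far₂) br (pull-left sp s+1∉α) ⟩
      just (v₁ ++ t ∷ s ∷ []) ∙ (just (t ∷ v₂) ∙ just (β ++ γ))
        ≈⟨ ∙-congˡ {just (v₁ ++ t ∷ s ∷ [])} ≈0 ⟩
      0# ∎
    ... | inj₂ R = inj₂ record
      { rest = proj₁ tail-cases
      ; raised = s ∷ raised
      ; rest⊆ = proj₁ (proj₂ tail-cases)
      ; cyc-raised = All.tabulate s▷raised ∷ cyc-raised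
      ; new = new
      ; new∈ = there (∈-++⁺ʳ v₁ new∈)
      ; new∉ = λ new∈α → [ proj₁ (s▷ new∈) ∘ sym , new∉ ]′ (∈α⇒ new∈α)
      ; raised↭ = ↭-trans (prep s raised↭) (↭-trans (swap s new ↭-refl) (prep new (↭-sym (shift s β γ))))
      ; factors = begin
          just (s ∷ v₁ ++ t ∷ v₂) ∙ just α
            ≈⟨ braid-through (a s) (a t) (just v₁) (just v₂) (just α) (just (β ++ γ))
                 (commute-word v₁ far₁) (commute-word v₂ far₂) br (pull-left sp s+1∉α) ⟩
          just (v₁ ++ t ∷ s ∷ []) ∙ (just (t ∷ v₂) ∙ just (β ++ γ))
            ≈⟨ ∙-congˡ {just (v₁ ++ t ∷ s ∷ [])} factors ⟩
          just (v₁ ++ t ∷ s ∷ []) ∙ (just rest ∙ just raised)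
            ≈⟨ proj₂ (proj₂ tail-cases) ⟩
          just (proj₁ tail-cases) ∙ just (s ∷ raised) ∎
      }
      where
      open Raise R

      ∈α⇒ : ∀ {j} → j ∈ˡ α → j ≡ s ⊎ j ∈ˡ β ++ γ
      ∈α⇒ j∈α with ∈-resp-↭ (shift s β γ) j∈α
      ... | here j≡s = inj₁ j≡s
      ... | there j∈ = inj₂ j∈

      s▷raised : ∀ {j} → j ∈ˡ raised → s ▷ j
      s▷raised j∈ with ∈-resp-↭ raised↭ j∈
      ... | here refl = s▷ new∈
      ... | there j∈α₁ with ∈-++⁻ β j∈α₁
      -- Here j stood to the left of s; moving s to the front is allowed because s + 1 ∉ α.
      ... | inj₁ j∈β = proj₁ (before′ j∈β (here refl)) ∘ sym , λ { refl → s+1∉α (∈-++⁺ˡ j∈β) }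
      ... | inj₂ j∈γ = All.lookup q′ j∈γ

      -- If the recursion dropped t from `rest`, then s commutes past `rest` and joins `raised`. If
      -- t was kept, the braid move is run backwards, which restores s on the left and puts another
      -- s before `raised`.
      tail-cases : Σ[ w ∈ Word ] (w ⊆ s ∷ v₁ ++ t ∷ v₂ ×
                     just (v₁ ++ t ∷ s ∷ []) ∙ (just rest ∙ just raised) ≈ just w ∙ just (s ∷ raised))
      tail-cases = cases rest rest⊆
        where
        cases : ∀ w → w ⊆ t ∷ v₂ →
          Σ[ w′ ∈ Word ] (w′ ⊆ s ∷ v₁ ++ t ∷ v₂ ×
            just (v₁ ++ t ∷ s ∷ []) ∙ (just w ∙ just raised) ≈ just w′ ∙ just (s ∷ raised))
        cases w (_ ∷ʳ τ) = v₁ ++ t ∷ w , s ∷ʳ ++⁺ ⊆-refl (refl Sublist.∷ τ) ,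
          move (just v₁) (a t) (a s) (just w) (just raised)
            (commute-word w (far₂ ∘ Sublist.lookup τ))
          where
          move : ∀ V T S W A → Commute S W → (V ∙ (T ∙ S)) ∙ (W ∙ A) ≈ (V ∙ (T ∙ W)) ∙ (S ∙ A)
          move V T S W A SW = begin
            (V ∙ (T ∙ S)) ∙ (W ∙ A)   ≈⟨ solve monoid ⟩
            V ∙ T ∙ (S ∙ W) ∙ A       ≈⟨ ∙-congʳ (∙-congˡ SW) ⟩
            V ∙ T ∙ (W ∙ S) ∙ A       ≈⟨ solve monoid ⟩
            (V ∙ (T ∙ W)) ∙ (S ∙ A)   ∎
        cases (_ ∷ w) (refl Sublist.∷ τ) = s ∷ v₁ ++ t ∷ w , refl Sublist.∷ ++⁺ ⊆-refl (refl Sublist.∷ τ) ,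
          ≈-sym (braid-through (a s) (a t) (just v₁) (just w) (just (s ∷ raised)) (just raised)
            (commute-word v₁ far₁) (commute-word w (far₂ ∘ Sublist.lookup τ)) br ≈-refl)

  -- Nestedness of maximal decompositions

  support : Word → Subset (suc k)
  support = foldr (λ i B → Subset.⁅ i ⁆ Subset.∪ B) Subset.⊥

  ∈-support⁺ : ∀ {i w} → i ∈ˡ w → i Subset.∈ support w
  ∈-support⁺ {i} (here refl)  = x∈p∪q⁺ (inj₁ (x∈⁅x⁆ i))
  ∈-support⁺     (there i∈w)  = x∈p∪q⁺ (inj₂ (∈-support⁺ i∈w))

  ∈-support⁻ : ∀ {i} w → i Subset.∈ support w → i ∈ˡ w
  ∈-support⁻ []      i∈ = contradiction i∈ ∉⊥
  ∈-support⁻ (j ∷ w) i∈ with x∈p∪q⁻ Subset.⁅ j ⁆ (support w) i∈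
  ... | inj₁ i∈⁅j⁆ = here (x∈⁅y⁆⇒x≡y j i∈⁅j⁆)
  ... | inj₂ i∈w   = there (∈-support⁻ w i∈w)

  word-factor : ∀ w → CycDec w → ∃ (_∈ˡ w) → ∃ (_∉ˡ w) → Factor
  word-factor w cw (i , i∈w) (j , j∉w) = record
    { A        = support w
    ; nonempty = i , ∈-support⁺ i∈w
    ; proper   = (λ _ → ∈⊤) , j , ∈⊤ , j∉w ∘ ∈-support⁻ w
    ; word     = w
    ; spells   = record
      { letters    = λ _ → mk⇔ ∈-support⁺ (∈-support⁻ w)
      ; once       = AllPairs.map proj₁ cw
      ; decreasing = AllPairs.map proj₂ cw
      }
    }

  open Factor using (word; spells)

  cyc : ∀ f → CycDec (word f)
  cyc f = spells⇒cycDec (spells f)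

  ∈-word⁺ : ∀ f {i} → i Subset.∈ A f → i ∈ˡ word f
  ∈-word⁺ f = Equivalence.from (Spells-d.letters (spells f) _)

  ∈-word⁻ : ∀ f {i} → i ∈ˡ word f → i Subset.∈ A f
  ∈-word⁻ f = Equivalence.to (Spells-d.letters (spells f) _)

  Nested : Factors → Set
  Nested = Linked (λ f g → ∀ {s} → s Subset.∈ A g → s ⊕ 1 Subset.∈ A f)

  Improvable : Factors → Set
  Improvable fs = Σ[ gs ∈ Factors ] (product fs ≈ product gs × ¬ map size gs ≤ₗₑₓ map size fs)

  -- Factors are nonempty, so an exhausted word contributes no factor; otherwise properness is
  -- inherited from `g`.
  append-word : ∀ fs g w → w ⊆ word g → Σ[ gs ∈ Factors ] product fs ∙ just w ≈ product gs
  append-word fs g []        τ = fs , ≡⇒≈ (∙-identityʳ (product fs))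
  append-word fs g w@(i ∷ _) τ with Factor.proper g
  ... | _ , m , _ , m∉A = g′ ∷ fs , ≈-refl
    where
    g′ = word-factor w (AllPairs-resp-⊆ τ (cyc g)) (i , here refl)
           (m , m∉A ∘ ∈-word⁻ g ∘ Sublist.lookup τ)

  -- The part of `word g` from s onwards is pushed into `word f`. A zero outcome would annihilate
  -- the whole product; otherwise the rightmost factor, whose size is compared first, gains a
  -- letter.
  improve : ∀ f g fs s → s Subset.∈ A g → s ⊕ 1 Subset.∉ A f →
            ¬ product (f ∷ g ∷ fs) ≈ 0# → Improvable (f ∷ g ∷ fs)
  improve f g fs s s∈Ag s+1∉Af nonzero with split (cyc g) (∈-word⁺ g s∈Ag)
  ... | record { u = u ; v = v ; eq = eq ; cyc-sv = cyc-sv }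
    with push (suc (length v)) s v (word f) ℕ.≤-refl cyc-sv (cyc f) (s+1∉Af ∘ ∈-word⁻ f)
  ... | inj₁ ≈0 = contradiction (begin
      product fs ∙ just (word g) ∙ d f
        ≈⟨ ≡⇒≈ (cong (λ w → product fs ∙ just w ∙ d f) eq) ⟩
      product fs ∙ (just u ∙ just (s ∷ v)) ∙ d f
        ≈⟨ ∙-assoc₄ (product fs) (just u) (just (s ∷ v)) (d f) ⟩
      product fs ∙ just u ∙ (just (s ∷ v) ∙ d f)          ≈⟨ ∙-congˡ {product fs ∙ just u} ≈0 ⟩
      product fs ∙ just u ∙ 0#                            ≈⟨ zeroʳ (product fs ∙ just u) ⟩
      0#                                                  ∎) nonzero
  ... | inj₂ R = f′ ∷ proj₁ gs , (begin
      product fs ∙ just (word g) ∙ d f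
        ≈⟨ ≡⇒≈ (cong (λ w → product fs ∙ just w ∙ d f) eq) ⟩
      product fs ∙ (just u ∙ just (s ∷ v)) ∙ d f
        ≈⟨ ∙-assoc₄ (product fs) (just u) (just (s ∷ v)) (d f) ⟩
      product fs ∙ just u ∙ (just (s ∷ v) ∙ d f)          ≈⟨ ∙-congˡ {product fs ∙ just u} factors ⟩
      product fs ∙ just u ∙ (just rest ∙ just raised)
        ≈⟨ ∙-assoc₄ (product fs) (just u) (just rest) (just raised) ⟨
      product fs ∙ (just u ∙ just rest) ∙ just raised     ≈⟨ ∙-congʳ {z = just raised} (proj₂ gs) ⟩
      product (proj₁ gs) ∙ just raised                    ∎) , λ where
        (this lt)   → ℕ.<-asym lt larger
        (next eq _) → ℕ.<⇒≢ larger (sym eq)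
    where
    open Raise R

    new∈raised : new ∈ˡ raised
    new∈raised = ∈-resp-↭ (↭-sym raised↭) (here refl)

    -- This keeps the enlarged factor proper: the new letter comes from s v, which avoids s + 1.
    s+1∉raised : s ⊕ 1 ∉ˡ raised
    s+1∉raised s+1∈ with ∈-resp-↭ raised↭ s+1∈
    ... | here s+1≡new  = cycDec-⊕1∉ cyc-sv (subst (_∈ˡ s ∷ v) (sym s+1≡new) new∈)
    ... | there s+1∈f   = s+1∉Af (∈-word⁻ f s+1∈f)

    f′ = word-factor raised cyc-raised (new , new∈raised) (s ⊕ 1 , s+1∉raised)

    gs = append-word fs g (u ++ rest) (subst (u ++ rest ⊆_) (sym eq) (++⁺ ⊆-refl rest⊆))

    larger : size f < size f′
    larger = p⊂q⇒∣p∣<∣q∣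
      ( (λ i∈Af → ∈-support⁺ (∈-resp-↭ (↭-sym raised↭) (there (∈-word⁺ f i∈Af))))
      , new , ∈-support⁺ new∈raised , new∉ ∘ ∈-word⁺ f )

  -- Improving the tail improves the whole list, since equal heads leave the lexicographic
  -- comparison to the tails.
  nested-or-improvable : ∀ fs → ¬ product fs ≈ 0# → Nested fs ⊎ Improvable fs
  nested-or-improvable []           nonzero = inj₁ []
  nested-or-improvable (f ∷ [])     nonzero = inj₁ [-]
  nested-or-improvable (f ∷ g ∷ fs) nonzero
    with nested-or-improvable (g ∷ fs) (λ ≈0 → nonzero (∙-congʳ {z = d f} ≈0))
  ... | inj₂ (gs , eq , larger) = inj₂ (f ∷ gs , ∙-congʳ {z = d f} eq , λ where
    (this lt)   → ℕ.<-irrefl refl lt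
    (next _ le) → larger le)
  ... | inj₁ nested with any? (λ s → s ∈? A g ×-dec ¬? (s ⊕ 1 ∈? A f))
  ... | yes (s , s∈Ag , s+1∉Af) = inj₂ (improve f g fs s s∈Ag s+1∉Af nonzero)
  ... | no ∄s = inj₁ ((λ {s} s∈Ag → decidable-stable (s ⊕ 1 ∈? A f) λ s+1∉Af → ∄s (s , s∈Ag , s+1∉Af)) ∷ nested)

  maximal⇒nested : ∀ x fs → IsMaximalDecomposition x fs → Nested fs
  maximal⇒nested x fs max with nested-or-improvable fs (nonzero x ∘ ≈-trans decomposes)
    where open IsMaximalDecomposition max
  ... | inj₁ nested = nested
  ... | inj₂ (gs , eq , larger) = contradiction (maximal gs (≈-trans decomposes eq)) larger
    where open IsMaximalDecomposition max

  -- A model of the monoid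

  -- The affine permutation f with f(i + k + 1) = f(i) + k + 1 is recorded by the
  -- periodic function f(i) − i, so that a_i may be applied, f(i) < f(i + 1), iff
  -- g i ≤ g (i + 1).
  State : Set
  State = I → ℤ

  -- The values f(i) and f(i + 1) trade places; moving a value by one position changes f(i) - i by
  -- one, whence `suc` and `pred`.
  record Step (i : I) (g h : State) : Set where
    field
      ascent : g i ℤ.≤ g (i ⊕ 1)
      at     : h i ≡ ℤ.suc (g (i ⊕ 1))
      at⁺    : h (i ⊕ 1) ≡ ℤ.pred (g i)
      off    : ∀ {j} → j ≢ i → j ≢ i ⊕ 1 → h j ≡ g j

  act : I → State → State
  act i g j with j ≟ i | j ≟ i ⊕ 1
  ... | yes _ | _     = ℤ.suc (g (i ⊕ 1))
  ... | no  _ | yes _ = ℤ.pred (g i)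
  ... | no  _ | no  _ = g j

  act-step : ∀ {i g} → g i ℤ.≤ g (i ⊕ 1) → Step i g (act i g)
  act-step {i} {g} ascent = record { ascent = ascent ; at = at ; at⁺ = at⁺ ; off = off }
    where
    at : act i g i ≡ ℤ.suc (g (i ⊕ 1))
    at with i ≟ i
    ... | yes _   = refl
    ... | no i≢i = contradiction refl i≢i

    at⁺ : act i g (i ⊕ 1) ≡ ℤ.pred (g i)
    at⁺ with i ⊕ 1 ≟ i | i ⊕ 1 ≟ i ⊕ 1
    ... | yes eq | _     = contradiction eq (⊕1≢ i)
    ... | no _   | yes _ = refl
    ... | no _   | no ≢  = contradiction refl ≢

    off : ∀ {j} → j ≢ i → j ≢ i ⊕ 1 → act i g j ≡ g j
    off {j} j≢i j≢i+1 with j ≟ i | j ≟ i ⊕ 1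
    ... | yes eq | _      = contradiction eq j≢i
    ... | no _   | yes eq = contradiction eq j≢i+1
    ... | no _   | no _   = refl

  -- States are functions, so the end point is prescribed only up to pointwise equality.
  Path : Word → State → State → Set
  Path []      g h = g ≗ h
  Path (i ∷ w) g h = Σ[ m ∈ State ] (Step i g m × Path w m h)

  -- The partial action as a relation. Zero is the empty relation, so a path witnesses that a
  -- product is nonzero.
  ⟦_⟧ : Element → State → State → Set
  ⟦ just w ⟧  g h = Path w g h
  ⟦ nothing ⟧ g h = ⊥

  step-respˡ : ∀ {i g g′ h} → g ≗ g′ → Step i g h → Step i g′ h
  step-respˡ {i} {g} {g′} {h} eq st = record
    { ascent = subst₂ ℤ._≤_ (eq i) (eq (i ⊕ 1)) ascent
    ; at     = trans at (cong ℤ.suc (eq (i ⊕ 1)))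
    ; at⁺    = trans at⁺ (cong ℤ.pred (eq i))
    ; off    = λ {j} ≢i ≢i+1 → trans (off ≢i ≢i+1) (eq j)
    }
    where open Step st

  path-respˡ : ∀ w {g g′ h} → g ≗ g′ → Path w g h → Path w g′ h
  path-respˡ []      eq p            = λ i → trans (sym (eq i)) (p i)
  path-respˡ (i ∷ w) eq (m , st , p) = m , step-respˡ eq st , p

  path-respʳ : ∀ w {g h h′} → h ≗ h′ → Path w g h → Path w g h′
  path-respʳ []      eq p            = λ i → trans (p i) (eq i)
  path-respʳ (i ∷ w) eq (m , st , p) = m , st , path-respʳ w eq p

  path-++⁺ : ∀ u {v g m h} → Path u g m → Path v m h → Path (u ++ v) g h
  path-++⁺ []      {v} p            q = path-respˡ v (λ i → sym (p i)) q
  path-++⁺ (i ∷ u)     (m , st , p) q = m , st , path-++⁺ u p q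

  path-++⁻ : ∀ u {v g h} → Path (u ++ v) g h → Σ[ m ∈ State ] (Path u g m × Path v m h)
  path-++⁻ []      {g = g} p = g , (λ _ → refl) , p
  path-++⁻ (i ∷ u) (m , st , p) with path-++⁻ u p
  ... | m′ , p₁ , p₂ = m′ , (m , st , p₁) , p₂

  ⟦∙⟧⁺ : ∀ x y {g m h} → ⟦ x ⟧ g m → ⟦ y ⟧ m h → ⟦ x ∙ y ⟧ g h
  ⟦∙⟧⁺ (just u) (just v) p q = path-++⁺ u p q

  ⟦∙⟧⁻ : ∀ x y {g h} → ⟦ x ∙ y ⟧ g h → Σ[ m ∈ State ] (⟦ x ⟧ g m × ⟦ y ⟧ m h)
  ⟦∙⟧⁻ (just u) (just v) p = path-++⁻ u p

  -- A second step would need g(i + 1) + 1 ≤ g(i) - 1, against g(i) ≤ g(i + 1) from the first.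
  step-² : ∀ {i g m h} → Step i g m → ¬ Step i m h
  step-² st st′ = ℤ.<-irrefl refl (ℤ.<-≤-trans
    (ℤ.suc[i]≤j⇒i<j (subst₂ ℤ._≤_ (Step.at st) (Step.at⁺ st) (Step.ascent st′)))
    (ℤ.i≤j⇒pred[i]≤j (Step.ascent st)))

  -- The net effect of two far steps. Its description is symmetric in i and j, which makes both
  -- orders agree.
  record Both (i j : I) (g h : State) : Set where
    field
      atᵢ  : h i ≡ ℤ.suc (g (i ⊕ 1))
      atᵢ⁺ : h (i ⊕ 1) ≡ ℤ.pred (g i)
      atⱼ  : h j ≡ ℤ.suc (g (j ⊕ 1))
      atⱼ⁺ : h (j ⊕ 1) ≡ ℤ.pred (g j)
      off  : ∀ {l} → l ≢ i → l ≢ i ⊕ 1 → l ≢ j → l ≢ j ⊕ 1 → h l ≡ g l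

  both : ∀ {i j g m h} → Far i j → Step i g m → Step j m h → Both i j g h
  both (j≢i , j≢i+1 , i≢j+1) s t = record
    { atᵢ  = trans (T.off (j≢i ∘ sym) i≢j+1) S.at
    ; atᵢ⁺ = trans (T.off (j≢i+1 ∘ sym) (j≢i ∘ sym ∘ ⊕1-injective)) S.at⁺
    ; atⱼ  = trans T.at (cong ℤ.suc (S.off (i≢j+1 ∘ sym) (j≢i ∘ ⊕1-injective)))
    ; atⱼ⁺ = trans T.at⁺ (cong ℤ.pred (S.off j≢i j≢i+1))
    ; off  = λ l≢i l≢i+1 l≢j l≢j+1 → trans (T.off l≢j l≢j+1) (S.off l≢i l≢i+1)
    }
    where
    module S = Step s
    module T = Step t

  both-unique : ∀ {i j g h h′} → Both i j g h → Both j i g h′ → h ≗ h′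
  both-unique {i} {j} b b′ l with l ≟ i | l ≟ i ⊕ 1 | l ≟ j | l ≟ j ⊕ 1
  ... | yes refl | _        | _        | _        = trans (Both.atᵢ b) (sym (Both.atⱼ b′))
  ... | no _     | yes refl | _        | _        = trans (Both.atᵢ⁺ b) (sym (Both.atⱼ⁺ b′))
  ... | no _     | no _     | yes refl | _        = trans (Both.atⱼ b) (sym (Both.atᵢ b′))
  ... | no _     | no _     | no _     | yes refl = trans (Both.atⱼ⁺ b) (sym (Both.atᵢ⁺ b′))
  ... | no ≢i    | no ≢i+1  | no ≢j    | no ≢j+1  =
    trans (Both.off b ≢i ≢i+1 ≢j ≢j+1) (sym (Both.off b′ ≢j ≢j+1 ≢i ≢i+1))

  far-sym : ∀ {i j} → Far i j → Far j i
  far-sym (j≢i , j≢i+1 , i≢j+1) = j≢i ∘ sym , i≢j+1 , j≢i+1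

  commute-path : ∀ {i j g h} → Far i j → Path (i ∷ j ∷ []) g h → Path (j ∷ i ∷ []) g h
  commute-path {i} {j} {g} {h} far@(j≢i , j≢i+1 , i≢j+1) (m , s , m′ , t , m′≗h) =
    act j g , s′ , act i (act j g) , t′ ,
    λ l → trans (sym (both-unique (both far s t) (both (far-sym far) s′ t′) l)) (m′≗h l)
    where
    s′ : Step j g (act j g)
    s′ = act-step (subst₂ ℤ._≤_ (Step.off s j≢i j≢i+1)
      (Step.off s (i≢j+1 ∘ sym) (j≢i ∘ ⊕1-injective)) (Step.ascent t))
    t′ : Step i (act j g) (act i (act j g))
    t′ = act-step (subst₂ ℤ._≤_ (sym (Step.off s′ (j≢i ∘ sym) i≢j+1))
      (sym (Step.off s′ (j≢i+1 ∘ sym) (j≢i ∘ sym ∘ ⊕1-injective))) (Step.ascent s))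

  -- The common effect of a_i a_j a_i and a_j a_i a_j, where j = i + 1 and l = i + 2.
  record Reversal (i j l : I) (g h : State) : Set where
    field
      gᵢ≤gⱼ : g i ℤ.≤ g j
      gⱼ≤gₗ : g j ℤ.≤ g l
      atᵢ   : h i ≡ ℤ.suc (ℤ.suc (g l))
      atⱼ   : h j ≡ g j
      atₗ   : h l ≡ ℤ.pred (ℤ.pred (g i))
      off   : ∀ {n} → n ≢ i → n ≢ j → n ≢ l → h n ≡ g n

  reversal-unique : ∀ {i j l g h h′} → Reversal i j l g h → Reversal i j l g h′ → h ≗ h′
  reversal-unique {i} {j} {l} r r′ n with n ≟ i | n ≟ j | n ≟ l
  ... | yes refl | _        | _        = trans (Reversal.atᵢ r) (sym (Reversal.atᵢ r′))
  ... | no _     | yes refl | _        = trans (Reversal.atⱼ r) (sym (Reversal.atⱼ r′))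
  ... | no _     | no _     | yes refl = trans (Reversal.atₗ r) (sym (Reversal.atₗ r′))
  ... | no ≢i    | no ≢j    | no ≢l    = trans (Reversal.off r ≢i ≢j ≢l) (sym (Reversal.off r′ ≢i ≢j ≢l))

  suc-cancel-≤ : ∀ {x y} → ℤ.suc x ℤ.≤ ℤ.suc y → x ℤ.≤ y
  suc-cancel-≤ {x} {y} le = subst₂ ℤ._≤_ (ℤ.pred-suc x) (ℤ.pred-suc y) (ℤ.pred-mono le)

  pred-cancel-≤ : ∀ {x y} → ℤ.pred x ℤ.≤ ℤ.pred y → x ℤ.≤ y
  pred-cancel-≤ {x} {y} le = subst₂ ℤ._≤_ (ℤ.suc-pred x) (ℤ.suc-pred y) (ℤ.suc-mono le)

  -- For k ≥ 2 the residues i, i + 1, i + 2 are pairwise distinct, so the steps permute three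
  -- separate entries.
  module _ (2≤k : 2 ≤ k) (i : I) where
    private
      j = i ⊕ 1
      l = j ⊕ 1

      i≢j : i ≢ j
      i≢j = ⊕1≢ i ∘ sym
      j≢l : j ≢ l
      j≢l = ⊕1≢ j ∘ sym
      i≢l : i ≢ l
      i≢l = ⊕1⊕1≢ 2≤k i ∘ sym

    reversal-iji : ∀ {g m₁ m₂ h} → Step i g m₁ → Step j m₁ m₂ → Step i m₂ h → Reversal i j l g h
    reversal-iji {g} {m₁} {m₂} {h} s₁ s₂ s₃ = record
      { gᵢ≤gⱼ = S₁.ascent
      ; gⱼ≤gₗ = suc-cancel-≤ (subst₂ ℤ._≤_ m₂i m₂j S₃.ascent)
      ; atᵢ   = trans S₃.at (cong ℤ.suc m₂j)
      ; atⱼ   = trans S₃.at⁺ (trans (cong ℤ.pred m₂i) (ℤ.pred-suc (g j)))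
      ; atₗ   = trans (S₃.off (i≢l ∘ sym) (j≢l ∘ sym)) (trans S₂.at⁺ (cong ℤ.pred S₁.at⁺))
      ; off   = λ ≢i ≢j ≢l → trans (S₃.off ≢i ≢j) (trans (S₂.off ≢j ≢l) (S₁.off ≢i ≢j))
      }
      where
      module S₁ = Step s₁
      module S₂ = Step s₂
      module S₃ = Step s₃
      m₂i : m₂ i ≡ ℤ.suc (g j)
      m₂i = trans (S₂.off i≢j i≢l) S₁.at
      m₂j : m₂ j ≡ ℤ.suc (g l)
      m₂j = trans S₂.at (cong ℤ.suc (S₁.off (i≢l ∘ sym) (j≢l ∘ sym)))

    reversal-jij : ∀ {g m₁ m₂ h} → Step j g m₁ → Step i m₁ m₂ → Step j m₂ h → Reversal i j l g h
    reversal-jij {g} {m₁} {m₂} {h} s₁ s₂ s₃ = record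
      { gᵢ≤gⱼ = pred-cancel-≤ (subst₂ ℤ._≤_ m₂j m₂l S₃.ascent)
      ; gⱼ≤gₗ = S₁.ascent
      ; atᵢ   = trans (S₃.off i≢j i≢l) (trans S₂.at (cong ℤ.suc S₁.at))
      ; atⱼ   = trans S₃.at (trans (cong ℤ.suc m₂l) (ℤ.suc-pred (g j)))
      ; atₗ   = trans S₃.at⁺ (cong ℤ.pred m₂j)
      ; off   = λ ≢i ≢j ≢l → trans (S₃.off ≢j ≢l) (trans (S₂.off ≢i ≢j) (S₁.off ≢j ≢l))
      }
      where
      module S₁ = Step s₁
      module S₂ = Step s₂
      module S₃ = Step s₃
      m₂j : m₂ j ≡ ℤ.pred (g i)
      m₂j = trans S₂.at⁺ (cong ℤ.pred (S₁.off i≢j i≢l))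
      m₂l : m₂ l ≡ ℤ.pred (g j)
      m₂l = trans (S₂.off (i≢l ∘ sym) (j≢l ∘ sym)) S₁.at⁺

    path-iji : ∀ {g h} → Reversal i j l g h → Path (i ∷ j ∷ i ∷ []) g h
    path-iji {g} r = _ , s₁ , _ , s₂ , _ , s₃ , reversal-unique (reversal-iji s₁ s₂ s₃) r
      where
      open Reversal r
      s₁ : Step i g (act i g)
      s₁ = act-step gᵢ≤gⱼ
      module S₁ = Step s₁
      s₂ : Step j (act i g) (act j (act i g))
      s₂ = act-step (subst₂ ℤ._≤_ (sym S₁.at⁺) (sym (S₁.off (i≢l ∘ sym) (j≢l ∘ sym)))
        (ℤ.i≤j⇒pred[i]≤j (ℤ.≤-trans gᵢ≤gⱼ gⱼ≤gₗ)))
      module S₂ = Step s₂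
      s₃ : Step i (act j (act i g)) (act i (act j (act i g)))
      s₃ = act-step (subst₂ ℤ._≤_ (sym (trans (S₂.off i≢j i≢l) S₁.at))
        (sym (trans S₂.at (cong ℤ.suc (S₁.off (i≢l ∘ sym) (j≢l ∘ sym)))))
        (ℤ.suc-mono gⱼ≤gₗ))

    path-jij : ∀ {g h} → Reversal i j l g h → Path (j ∷ i ∷ j ∷ []) g h
    path-jij {g} r = _ , s₁ , _ , s₂ , _ , s₃ , reversal-unique (reversal-jij s₁ s₂ s₃) r
      where
      open Reversal r
      s₁ : Step j g (act j g)
      s₁ = act-step gⱼ≤gₗ
      module S₁ = Step s₁
      s₂ : Step i (act j g) (act i (act j g))
      s₂ = act-step (subst₂ ℤ._≤_ (sym (S₁.off i≢j i≢l)) (sym S₁.at)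
        (ℤ.i≤j⇒i≤1+j (ℤ.≤-trans gᵢ≤gⱼ gⱼ≤gₗ)))
      module S₂ = Step s₂
      s₃ : Step j (act i (act j g)) (act j (act i (act j g)))
      s₃ = act-step (subst₂ ℤ._≤_ (sym (trans S₂.at⁺ (cong ℤ.pred (S₁.off i≢j i≢l))))
        (sym (trans (S₂.off (i≢l ∘ sym) (j≢l ∘ sym)) S₁.at⁺))
        (ℤ.pred-mono gᵢ≤gⱼ))

  -- Each defining relation holds in the model. Both directions are carried together because `≈-sym`
  -- exchanges them.
  sound : ∀ {x y} → x ≈ y → ∀ {g h} → (⟦ x ⟧ g h → ⟦ y ⟧ g h) × (⟦ y ⟧ g h → ⟦ x ⟧ g h)
  sound ≈-refl        = (λ p → p) , λ p → p
  sound (≈-sym eq)    = proj₂ (sound eq) , proj₁ (sound eq)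
  sound (≈-trans e f) = proj₁ (sound f) ∘ proj₁ (sound e) , proj₂ (sound e) ∘ proj₂ (sound f)
  sound (∙-cong {x} {x′} {y} {y′} e f) =
    (λ p → let m , p₁ , p₂ = ⟦∙⟧⁻ x y p in ⟦∙⟧⁺ x′ y′ (proj₁ (sound e) p₁) (proj₁ (sound f) p₂)) ,
    (λ p → let m , p₁ , p₂ = ⟦∙⟧⁻ x′ y′ p in ⟦∙⟧⁺ x y (proj₂ (sound e) p₁) (proj₂ (sound f) p₂))
  sound (a²≈0 i) = (λ (_ , s , _ , t , _) → step-² s t) , λ ()
  sound (commute i j j≢i j≢i+1 i≢j+1) =
    commute-path (j≢i , j≢i+1 , i≢j+1) , commute-path (far-sym (j≢i , j≢i+1 , i≢j+1))
  sound (braid 2≤k i) =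
    (λ (_ , s₁ , _ , s₂ , _ , s₃ , eq) → path-respʳ (i ⊕ 1 ∷ i ∷ i ⊕ 1 ∷ []) eq
      (path-jij 2≤k i (reversal-iji 2≤k i s₁ s₂ s₃))) ,
    (λ (_ , s₁ , _ , s₂ , _ , s₃ , eq) → path-respʳ (i ∷ i ⊕ 1 ∷ i ∷ []) eq
      (path-iji 2≤k i (reversal-jij 2≤k i s₁ s₂ s₃)))

  -- Left-to-right maxima

  -- For f as above, f(t) exceeds f(q) for all q < t.
  LRmax : State → I → Set
  LRmax g t = ∀ q m → q ⊕ suc m ≡ t → g q ℤ.≤ + m ℤ.+ g t

  -- At distance m + 1 below t, the inequality f(q) < f(t) reads g(q) ≤ m + g(t); here m = 0.
  LRmax⇒ascent : ∀ {g} i → LRmax g (i ⊕ 1) → g i ℤ.≤ g (i ⊕ 1)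
  LRmax⇒ascent {g} i max = subst (g i ℤ.≤_) (ℤ.+-identityˡ _) (max i 0 refl)

  -- As t is neither s nor s + 1, every swapped pair of positions lies on one side of t, so the set
  -- of values below t is unchanged.
  LRmax-off : ∀ {s g h t} → Step s g h → t ≢ s → t ≢ s ⊕ 1 → LRmax g t → LRmax h t
  LRmax-off {s} {g} {h} {t} st t≢s t≢s+1 max q m q+1+m≡t =
    subst (λ z → h q ℤ.≤ + m ℤ.+ z) (sym (off t≢s t≢s+1)) (cases m q+1+m≡t (q ≟ s) (q ≟ s ⊕ 1))
    where
    open Step st
    cases : ∀ m → q ⊕ suc m ≡ t → Dec (q ≡ s) → Dec (q ≡ s ⊕ 1) → h q ℤ.≤ + m ℤ.+ g t
    cases m       eq (no q≢s)   (no q≢s+1) = subst (ℤ._≤ + m ℤ.+ g t) (sym (off q≢s q≢s+1)) (max q m eq)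
    -- Distance one from s would make t equal to s + 1.
    cases zero    eq (yes refl) _          = contradiction (sym eq) t≢s+1
    cases (suc m) eq (yes refl) _          = subst₂ ℤ._≤_ (sym at) (sym (ℤ.suc-+ m (g t)))
      (ℤ.suc-mono (max (s ⊕ 1) m (trans (⊕-⊕ s 1 (suc m)) eq)))
    cases m       eq (no _)     (yes refl) = subst₂ ℤ._≤_ (sym at⁺)
      (trans (cong ℤ.pred (ℤ.suc-+ m (g t))) (ℤ.pred-suc _))
      (ℤ.pred-mono (max s (suc m) (trans (sym (⊕-⊕ s 1 (suc m))) eq)))

  -- The maximum at s + 1 moves down to s, and everything then below s came from positions below s +
  -- 1.
  LRmax-at : ∀ {s g h} → Step s g h → LRmax g (s ⊕ 1) → LRmax h s
  LRmax-at {s} {g} {h} st max q m q+1+m≡s =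
    subst (λ z → h q ℤ.≤ + m ℤ.+ z) (sym at) (cases (q ≟ s) (q ≟ s ⊕ 1))
    where
    open Step st
    cases : Dec (q ≡ s) → Dec (q ≡ s ⊕ 1) → h q ℤ.≤ + m ℤ.+ ℤ.suc (g (s ⊕ 1))
    cases (yes refl) _ = subst (ℤ._≤ + m ℤ.+ ℤ.suc (g (s ⊕ 1))) (sym at)
      (ℤ.i≤j⇒i≤k+j (+ m) ℤ.≤-refl)
    cases (no _) (yes refl) = subst (ℤ._≤ + m ℤ.+ ℤ.suc (g (s ⊕ 1))) (sym at⁺)
      (ℤ.i≤j⇒pred[i]≤j (ℤ.i≤j⇒i≤k+j (+ m) (ℤ.i≤j⇒i≤1+j ascent)))
    cases (no q≢s) (no q≢s+1) = subst₂ ℤ._≤_ (sym (off q≢s q≢s+1)) reorder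
      (max q (suc m) (trans (cong (q ⊕_) (ℕ.+-comm 1 (suc m))) (trans (sym (⊕-⊕ q (suc m) 1)) (cong (_⊕ 1) q+1+m≡s))))
      where
      reorder : + suc m ℤ.+ g (s ⊕ 1) ≡ + m ℤ.+ ℤ.suc (g (s ⊕ 1))
      reorder = trans (cong (ℤ._+ g (s ⊕ 1)) (ℤ.+-comm (+ 1) (+ m))) (ℤ.+-assoc (+ m) (+ 1) (g (s ⊕ 1)))

  -- d_A moves the entry at t ∈ A to t + 1, and the left-to-right maximum just above
  -- each run of A to the bottom of that run. X is the set of positions in which no
  -- moved entry has been placed so far.
  record Sweep (X : I → Set) (w : Word) (g : State) : Set where
    field
      final  : State
      path   : Path w g final
      max    : ∀ {t} → X t → pred t ∉ˡ w → LRmax final t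
      moved  : ∀ {t} → t ∈ˡ w → final (t ⊕ 1) ≡ ℤ.pred (g t)
      intact : ∀ {t} → t ∉ˡ w → pred t ∉ˡ w → final t ≡ g t

  -- Induction along the word. For its first letter s, position s + 1 lies in X and outside the
  -- word, so it holds a left-to-right maximum and the step applies; that maximum then sits at s,
  -- and s + 1 leaves X.
  sweep : ∀ X w g → CycDec w → (∀ {t} → t ∈ˡ w → X (t ⊕ 1)) →
          (∀ {t} → X t → t ∉ˡ w → LRmax g t) → Sweep X w g
  sweep X [] g _ _ max = record
    { final  = g
    ; path   = λ _ → refl
    ; max    = λ Xt _ → max Xt λ ()
    ; moved  = λ ()
    ; intact = λ _ _ → refl
    }
  sweep X (s ∷ w) g cw@(p ∷ cyc-w) Xw max = record
    { final  = final
    ; path   = act s g , st , path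
    ; max    = λ {t} Xt t-1∉ → max′ (Xt , λ { refl → t-1∉ (here (⊕1-pred s)) }) (t-1∉ ∘ there)
    ; moved  = moved-s
    ; intact = λ {t} t∉ t-1∉ → trans (intact (t∉ ∘ there) (t-1∉ ∘ there))
                 (off (t∉ ∘ here) λ { refl → t-1∉ (here (⊕1-pred s)) })
    }
    where
    s+1∉ : s ⊕ 1 ∉ˡ s ∷ w
    s+1∉ = cycDec-⊕1∉ cw

    s∉w : s ∉ˡ w
    s∉w s∈w = proj₁ (All.lookup p s∈w) refl

    max-s+1 : LRmax g (s ⊕ 1)
    max-s+1 = max (Xw (here refl)) s+1∉

    st : Step s g (act s g)
    st = act-step (LRmax⇒ascent s max-s+1)
    open Step st

    X′ : I → Set
    X′ t = X t × t ≢ s ⊕ 1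

    max-act : ∀ {t} → Dec (t ≡ s) → X′ t → t ∉ˡ w → LRmax (act s g) t
    max-act (yes refl) _            _   = LRmax-at st max-s+1
    max-act (no t≢s)   (Xt , t≢s+1) t∉w =
      LRmax-off st t≢s t≢s+1 (max Xt λ { (here eq) → t≢s eq ; (there t∈w) → t∉w t∈w })

    open Sweep (sweep X′ w (act s g) cyc-w
      (λ t∈w → Xw (there t∈w) , λ t+1≡s+1 → s∉w (subst (_∈ˡ w) (⊕1-injective t+1≡s+1) t∈w))
      (λ {t} → max-act (t ≟ s)))
      renaming (max to max′)

    moved-s : ∀ {t} → t ∈ˡ s ∷ w → final (t ⊕ 1) ≡ ℤ.pred (g t)
    -- The later letters include neither s nor s + 1, so the entry just placed at s + 1 stays there.
    moved-s (here refl) = trans (intact (s+1∉ ∘ there) (s∉w ∘ subst (_∈ˡ w) (⊕1-pred s))) at⁺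
    moved-s (there t∈w) = trans (moved t∈w)
      (cong ℤ.pred (off (λ { refl → s∉w t∈w }) λ { refl → s+1∉ (there t∈w) }))

  -- Descents of nested products

  -- Column r contains a descent; its boxes above row 1 form column r − 1 of fs.
  Desc : Factors → I → Set
  Desc []       r = ⊥
  Desc (f ∷ fs) r = r Subset.∈ A f × (pred r Subset.∉ A f ⊎ Desc fs (pred r))

  Desc? : ∀ fs r → Dec (Desc fs r)
  Desc? []       r = no λ ()
  Desc? (f ∷ fs) r = r ∈? A f ×-dec (¬? (pred r ∈? A f) ⊎-dec Desc? fs (pred r))

  desc⇒zero : ∀ fs {r} → Desc fs r → product fs ∙ a r ≈ 0#
  desc⇒zero (f ∷ fs) {r} (r∈A , inj₁ r-1∉A) = begin
    product fs ∙ d f ∙ a r     ≈⟨ ≡⇒≈ (∙-assoc (product fs) (d f) (a r)) ⟩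
    product fs ∙ (d f ∙ a r)
      ≈⟨ ∙-congˡ {product fs} (right-zero (cyc f) (∈-word⁺ f r∈A) (r-1∉A ∘ ∈-word⁻ f)) ⟩
    product fs ∙ 0#            ≈⟨ zeroʳ (product fs) ⟩
    0#                         ∎
  desc⇒zero (f ∷ fs) {r} (r∈A , inj₂ desc) with pred r ∈? A f
  -- The second alternative of `Desc` does not exclude r - 1 ∉ A, which is the first case again.
  ... | no r-1∉A  = desc⇒zero (f ∷ fs) (r∈A , inj₁ r-1∉A)
  ... | yes r-1∈A = begin
    product fs ∙ d f ∙ a r            ≈⟨ ≡⇒≈ (∙-assoc (product fs) (d f) (a r)) ⟩
    product fs ∙ (d f ∙ a r)
      ≈⟨ ∙-congˡ {product fs} (slide (cyc f) (∈-word⁺ f r∈A) (∈-word⁺ f r-1∈A)) ⟩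
    product fs ∙ (a (pred r) ∙ d f)   ≈⟨ ≡⇒≈ (∙-assoc (product fs) (a (pred r)) (d f)) ⟨
    product fs ∙ a (pred r) ∙ d f     ≈⟨ ∙-congʳ {z = d f} (desc⇒zero fs desc) ⟩
    0#                                ∎

  Free : Factors → I → Set
  Free []      q = ⊤
  Free (f ∷ _) q = q Subset.∉ A f

  record Realisation (fs : Factors) : Set where
    field
      final   : State
      -- The zero state is the identity permutation.
      path    : ⟦ product fs ⟧ (λ _ → 0ℤ) final
      max     : ∀ {q} → Free fs q → LRmax final (q ⊕ 1)
      ascents : ∀ {r} → ¬ Desc fs r → final r ℤ.≤ final (r ⊕ 1)

  -- By nestedness t ∉ A_f forces t - 1 outside the preceding factor, so by induction t holds a
  -- left-to-right maximum before d_f acts, as `sweep` requires.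
  realise : ∀ fs → Nested fs → Realisation fs
  realise [] _ = record
    { final   = λ _ → 0ℤ
    ; path    = λ _ → refl
    ; max     = λ _ _ m _ → ℤ.i≤j⇒i≤k+j (+ m) ℤ.≤-refl
    ; ascents = λ _ → ℤ.≤-refl
    }
  realise (f ∷ fs) nested = record
    { final   = final
    ; path    = ⟦∙⟧⁺ (product fs) (d f) IH.path path
    ; max     = λ q∉A → max-final q∉A
    ; ascents = λ {r} → ascents-final r
    }
    where
    module IH = Realisation (realise fs (Linked.tail nested))

    free : ∀ fs → Nested (f ∷ fs) → ∀ {t} → t ∉ˡ word f → Free fs (pred t)
    free []       _             t∉     = _
    free (g ∷ _) (A⊆ ∷ _) {t}   t∉ t-1∈ = t∉ (∈-word⁺ f (subst (Subset._∈ A f) (pred-⊕1 t) (A⊆ t-1∈)))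

    open Sweep (sweep (λ _ → ⊤) (word f) IH.final (cyc f) _
      (λ {t} _ t∉ → subst (LRmax IH.final) (pred-⊕1 t) (IH.max (free fs nested t∉))))

    max-final : ∀ {q} → q Subset.∉ A f → LRmax final (q ⊕ 1)
    max-final {q} q∉A = max _ (q∉A ∘ ∈-word⁻ f ∘ subst (_∈ˡ word f) (⊕1-pred q))

    ascents-final : ∀ r → ¬ Desc (f ∷ fs) r → final r ℤ.≤ final (r ⊕ 1)
    ascents-final r ¬desc with r ∈? A f | pred r ∈? A f
    ... | no r∉A  | _         = LRmax⇒ascent r (max-final r∉A)
    ... | yes r∈A | no r-1∉A  = contradiction (r∈A , inj₁ r-1∉A) ¬desc
    -- The entries at r and r + 1 were moved up from r - 1 and r, so they compare as those did
    -- before d_f.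
    ... | yes r∈A | yes r-1∈A = subst₂ ℤ._≤_
      (trans (sym (moved (∈-word⁺ f r-1∈A))) (cong final (pred-⊕1 r)))
      (sym (moved (∈-word⁺ f r∈A)))
      (ℤ.pred-mono (subst (λ i → IH.final (pred r) ℤ.≤ IH.final i) (pred-⊕1 r)
        (IH.ascents (λ desc → ¬desc (r∈A , inj₂ desc)))))

  -- Without `Desc` the realised state has an ascent at r, so its path extends by a_r, whereas zero
  -- has no path.
  zero⇒desc : ∀ fs → Nested fs → ∀ {r} → product fs ∙ a r ≈ 0# → Desc fs r
  zero⇒desc fs nested {r} ≈0 = decidable-stable (Desc? fs r) λ ¬desc →
    proj₁ (sound ≈0) (⟦∙⟧⁺ (product fs) (a r) path
      (act r final , act-step (ascents ¬desc) , λ _ → refl))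
    where open Realisation (realise fs nested)

  -- The converse of `right-zero`, read off from a column of height one.
  descent-in-factor : ∀ f {r} → d f ∙ a r ≈ 0# → r Subset.∈ A f × pred r Subset.∉ A f
  descent-in-factor f ≈0 with zero⇒desc (f ∷ []) [-] ≈0
  ... | r∈A , inj₁ r-1∉A = r∈A , r-1∉A

  -- Boxes and columns of the filling

  lift-box : ∀ {f fs} → Box fs → Box (f ∷ fs)
  lift-box b = record { row = suc (row b) ; residue = residue b ; inside = Box.inside b }

  column-suc : ∀ i n → i ⊕ suc n ≡ i ⊕ n ⊕ 1
  column-suc i n = trans (cong (i ⊕_) (ℕ.+-comm 1 n)) (sym (⊕-⊕ i n 1))

  -- A box found in column r - 1 of the upper factors keeps its residue but rises one row, which
  -- brings it into column r.
  desc⇒box : ∀ fs {r} → Desc fs r → Σ[ c ∈ Box fs ] (column c ≡ r × IsDescent c)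
  desc⇒box (f ∷ fs) {r} (r∈A , desc) with pred r ∈? A f | desc
  ... | no r-1∉A | _ =
    record { row = zero ; residue = r ; inside = r∈A } , ⊕-identityʳ r ,
    right-zero (cyc f) (∈-word⁺ f r∈A) (r-1∉A ∘ ∈-word⁻ f)
  ... | yes r-1∈A | inj₁ r-1∉A = contradiction r-1∈A r-1∉A
  ... | yes _     | inj₂ desc′ with desc⇒box fs desc′
  ... | c , column≡ , isDesc =
    lift-box c , trans (column-suc (residue c) _) (trans (cong (_⊕ 1) column≡) (pred-⊕1 r)) , isDesc

  -- Descending from the box, nestedness supplies the boxes beneath it down to the first row.
  box⇒desc : ∀ fs → Nested fs → ∀ {r} (c : Box fs) → column c ≡ r → IsDescent c → Desc fs r
  box⇒desc (f ∷ fs) _ record { row = zero ; residue = i } refl isDesc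
    with descent-in-factor f isDesc
  ... | i∈A , i-1∉A = subst (Desc (f ∷ fs)) (sym (⊕-identityʳ i)) (i∈A , inj₁ i-1∉A)
  box⇒desc (f ∷ g ∷ fs) (A⊆ ∷ nested) {r} record { row = suc j ; residue = i ; inside = inside } refl isDesc
    with box⇒desc (g ∷ fs) nested record { row = j ; residue = i ; inside = inside } refl isDesc
  ... | desc =
    subst (Subset._∈ A f) (sym column≡) (A⊆ (proj₁ desc)) ,
    inj₂ (subst (Desc (g ∷ fs)) (sym (trans (cong pred column≡) (⊕1-pred _))) desc)
    where
    column≡ = column-suc i (toℕ j)

  first-row-box : ∀ fs {r} → Desc fs r → Σ[ b ∈ Box fs ] (InFirstRow b × residue b ≡ r × column b ≡ r)
  first-row-box (f ∷ fs) {r} (r∈A , _) =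
    record { row = zero ; residue = r ; inside = r∈A } , refl , refl , ⊕-identityʳ r

  first-row-column : ∀ {fs} (b : Box fs) → InFirstRow b → column b ≡ residue b
  first-row-column b row≡0 = trans (cong (residue b ⊕_) row≡0) (⊕-identityʳ (residue b))

  descents : ∀ x fs → IsMaximalDecomposition x fs → ∀ r → r ∈ D_R (element x) ⇔
    (Σ[ b ∈ Box fs ] (InFirstRow b × residue b ≡ r ×
    (Σ[ c ∈ Box fs ] (column c ≡ column b × IsDescent c))))
  descents x fs max r = mk⇔ to from
    where
    open IsMaximalDecomposition max
    nested = maximal⇒nested x fs max

    to : r ∈ D_R (element x) → _
    to ≈0 with zero⇒desc fs nested (≈-trans (∙-congʳ {z = a r} (≈-sym decomposes)) ≈0)
    ... | desc with first-row-box fs desc | desc⇒box fs desc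
    ... | b , row≡0 , residue≡ , column-b≡ | c , column-c≡ , isDesc =
      b , row≡0 , residue≡ , c , trans column-c≡ (sym column-b≡) , isDesc

    from : _ → r ∈ D_R (element x)
    from (b , row≡0 , refl , c , column≡ , isDesc) = ≈-trans (∙-congʳ {z = a r} decomposes)
      (desc⇒zero fs (box⇒desc fs nested c (trans column≡ (first-row-column b row≡0)) isDesc))

corollary36 : (k : ℕ) → 1 ≤ k → let open NilCoxeter k in
    (x : AffinePermutation) (ds : Factors) → IsMaximalDecomposition x ds →
    (r : I) →
    r ∈ D_R (element x) ⇔
    (Σ[ b ∈ Box ds ] (InFirstRow b × residue b ≡ r ×
    (Σ[ c ∈ Box ds ] (column c ≡ column b × IsDescent c))))
corollary36 k 1≤k = Descents.descents k 1≤k
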